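{- If $n$ is a positive integer and $p$, $q$ and $t$ are any integers, then $$\sum_{k=0}^n\frac{(-1)^{(n-k)q}\,n}{n+k}\binom{n+k}{n-k}F_{p+q}^{n-k}F_p^{n-k}F_q^{2k}L_{k(2p+q)+t}=\frac12\left(F_{p+q}^{2n}L_{t+qn}+F_p^{2n}L_{t-qn}\right),$$ $$\sum_{k=0}^n\frac{(-1)^{(n-k)q}\,n}{n+k}\binom{n+k}{n-k}F_{p+q}^{n-k}F_p^{n-k}F_q^{2k}F_{k(2p+q)+t}=\frac12\left(F_{p+q}^{2n}F_{t+qn}+F_p^{2n}F_{t-qn}\right),$$ $$\sum_{k=0}^n\frac{(-1)^{(n-k)q}\,n}{n+k}\binom{n+k}{n-k}5^kL_{p+q}^{n-k}L_p^{n-k}F_q^{2k}L_{k(2p+q)+t}=\frac12\left(L_{p+q}^{2n}L_{t+qn}+L_p^{2n}L_{t-qn}\right),$$ $$\sum_{k=0}^n\frac{(-1)^{(n-k)q}\,n}{n+k}\binom{n+k}{n-k}5^kL_{p+q}^{n-k}L_p^{n-k}F_q^{2k}F_{k(2p+q)+t}=\frac12\left(L_{p+q}^{2n}F_{t+qn}+L_p^{2n}F_{t-qn}\right).$$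
   Context: $F_n$ and $L_n$ ($n\in\mathbb{Z}$) are the Fibonacci and Lucas numbers: $F_0=0$, $F_1=1$, $F_n=F_{n-1}+F_{n-2}$; $L_0=2$, $L_1=1$, $L_n=L_{n-1}+L_{n-2}$, extended to negative indices by $F_{ -n}=(-1)^{n-1}F_n$, $L_{ -n}=(-1)^nL_n$. The convention $0^0=1$ is used. -}

module Defs where

open import Data.Nat.Base as ℕ using (ℕ; zero; suc; NonZero)
import Data.Nat.Properties as ℕ
open import Data.Integer.Base using (ℤ; +_; -[1+_]; -1ℤ; _*_; _^_; ∣_∣)
open import Data.Rational.Base using (ℚ; _/_)

fib : ℕ → ℕ
fib zero          = 0
fib (suc zero)    = 1
fib (suc (suc n)) = fib (suc n) ℕ.+ fib n

luc : ℕ → ℕ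
luc zero          = 2
luc (suc zero)    = 1
luc (suc (suc n)) = luc (suc n) ℕ.+ luc n

-- (-1)^i for an integer exponent i; it equals (-1)^∣i∣ since -1 is its own inverse.
infix 9 -1^_
-1^_ : ℤ → ℤ
-1^ i = -1ℤ ^ ∣ i ∣

-- F₋ₘ = (-1)^(m-1) Fₘ, where -[1+ n ] = -m with m = n + 1.
F : ℤ → ℤ
F (+ n)    = + fib n
F -[1+ n ] = -1^ (+ n) * + fib (suc n)

-- L₋ₘ = (-1)^m Lₘ, with m = n + 1 again.
L : ℤ → ℤ
L (+ n)    = + luc n
L -[1+ n ] = -1^ (+ suc n) * + luc (suc n)

fromℤ : ℤ → ℚ
fromℤ i = i / 1

instance
  m+n-nonZero : ∀ {m n} .{{_ : NonZero m}} → NonZero (m ℕ.+ n)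
  m+n-nonZero {m} {n} = ℕ.>-nonZero (ℕ.≤-trans (ℕ.>-nonZero⁻¹ m) (ℕ.m≤m+n m n))

{-# OPTIONS --safe #-}

-- Fix a sequence U with the Fibonacci recurrence and put m = 2p + q, c = (-1)^q x y.  For
-- (x , y , f) = (F(p+q) , F(p) , F(q)²) or (L(p+q) , L(p) , 5 F(q)²) one has, for every s,
--   x² U(s+q) + y² U(s-q) = f U(s+m) + 2c U(s).
-- Writing E for the shift, this says X + Y = f E^m + 2c for the commuting operators X = x² E^q
-- and Y = y² E^(-q), while X Y = c².  Hence Xⁿ + Yⁿ is the Lucas-type polynomial
-- Σ 2n/(n+k) C(n+k,n-k) c^(n-k) (f E^m)^k; its coefficients are C(n+k,2k) + C(n+k-1,2k),
-- sums of two Morgan-Voyce coefficients, for which Pascal's rule gives first order recurrences.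
module Submission where

open import Defs
open import Data.Nat.Base as ℕ using (ℕ; zero; suc; NonZero; z≤n; s≤s)
import Data.Nat.Properties as ℕ
open import Data.Nat.Combinatorics using (_C_; nCk+nC[k+1]≡[n+1]C[k+1]; nCk≡nC[n∸k]; nC1≡n; k>n⇒nCk≡0)
import Data.Nat.Tactic.RingSolver as ℕ
open import Data.Integer.Base using (ℤ; +_; -[1+_]; 0ℤ; 1ℤ; -1ℤ; -_; _+_; _-_; _*_; _^_; ∣_∣) renaming (suc to sucℤ)
import Data.Integer.Properties as ℤ
open import Data.Integer.Tactic.RingSolver using (solve-∀)
open import Data.Rational.Base as ℚ using (ℚ; ½; _/_; toℚᵘ)
import Data.Rational.Properties as ℚ
open import Data.Rational.Properties using (+-0-monoid)
open import Data.Rational.Unnormalised.Base as ℚᵘ using (mkℚᵘ; *≡*)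
import Data.Rational.Unnormalised.Properties as ℚᵘ
open import Algebra.Properties.AbelianGroup ℤ.+-0-abelianGroup using (∙-cancelˡ)
open import Algebra.Properties.Monoid.Sum +-0-monoid using (sum⁺-syntax)
open import Data.Fin.Base using (toℕ)
open import Data.Product.Base using (_×_; _,_; proj₁; proj₂)
open import Function.Base using (_∘_)
open import Relation.Binary.PropositionalEquality

-- Sequences over ℤ with the Fibonacci recurrence

record Gibonacci (G : ℤ → ℤ) : Set where
  field
    recurrence : ∀ i → G (sucℤ (sucℤ i)) ≡ G (sucℤ i) + G i

open Gibonacci

F-gibonacci : Gibonacci F
F-gibonacci .recurrence (+ n)              = refl
-- At -1 and -2 a successor reaches the nonnegative branch, so these cases compute; from -3 downward
-- all three values carry signs.
F-gibonacci .recurrence -[1+ 0 ]           = refl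
F-gibonacci .recurrence -[1+ 1 ]           = refl
F-gibonacci .recurrence -[1+ suc (suc n) ] = identity (-1^ (+ n)) (+ fib (suc (suc n))) (+ fib (suc n))
  where
  identity : ∀ e g h → e * h ≡ -1ℤ * e * g + -1ℤ * (-1ℤ * e) * (g + h)
  identity = solve-∀

L-gibonacci : Gibonacci L
L-gibonacci .recurrence (+ n)              = refl
L-gibonacci .recurrence -[1+ 0 ]           = refl
L-gibonacci .recurrence -[1+ 1 ]           = refl
L-gibonacci .recurrence -[1+ suc (suc n) ] = identity (-1^ (+ suc n)) (+ luc (suc (suc n))) (+ luc (suc n))
  where
  identity : ∀ e g h → e * h ≡ -1ℤ * e * g + -1ℤ * (-1ℤ * e) * (g + h)
  identity = solve-∀

-- Two consecutive values determine the sequence in both directions: the recurrence gives each next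
-- value, and cancelling the middle term gives each previous one. Identities in an index below
-- reduce to checks at 0 and 1.
gibonacci-unique : ∀ {G H} → Gibonacci G → Gibonacci H →
                   G 0ℤ ≡ H 0ℤ → G 1ℤ ≡ H 1ℤ → ∀ i → G i ≡ H i
gibonacci-unique {G} {H} gG gH eq₀ eq₁ = λ where
    (+ n)    → proj₁ (nonneg n)
    -[1+ n ] → proj₁ (neg n)
  where
  nonneg : ∀ n → G (+ n) ≡ H (+ n) × G (+ suc n) ≡ H (+ suc n)
  nonneg zero    = eq₀ , eq₁
  nonneg (suc n) with nonneg n
  ... | eqₙ , eqₛ = eqₛ , trans (gG .recurrence (+ n)) (trans (cong₂ _+_ eqₛ eqₙ) (sym (gH .recurrence (+ n))))

  back : ∀ i → G (sucℤ i) ≡ H (sucℤ i) → G (sucℤ (sucℤ i)) ≡ H (sucℤ (sucℤ i)) → G i ≡ H i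
  back i eq eq′ = ∙-cancelˡ (G (sucℤ i)) _ _ (begin
    G (sucℤ i) + G i  ≡⟨ gG .recurrence i ⟨
    G (sucℤ (sucℤ i)) ≡⟨ eq′ ⟩
    H (sucℤ (sucℤ i)) ≡⟨ gH .recurrence i ⟩
    H (sucℤ i) + H i  ≡⟨ cong (_+ H i) eq ⟨
    G (sucℤ i) + H i  ∎)
    where open ≡-Reasoning

  neg : ∀ n → G -[1+ n ] ≡ H -[1+ n ] × G (sucℤ -[1+ n ]) ≡ H (sucℤ -[1+ n ])
  neg zero    = back -1ℤ eq₀ eq₁ , eq₀
  neg (suc n) with neg n
  ... | eqₙ , eqₚ = back -[1+ suc n ] eqₙ eqₚ , eqₙ

gibonacci-shift : ∀ {G} → Gibonacci G → ∀ s → Gibonacci (λ i → G (s + i))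
gibonacci-shift {G} gG s .recurrence i = begin
  G (s + sucℤ (sucℤ i))           ≡⟨ cong G (index₂ s i) ⟩
  G (sucℤ (sucℤ (s + i)))         ≡⟨ gG .recurrence (s + i) ⟩
  G (sucℤ (s + i)) + G (s + i)    ≡⟨ cong (λ j → G j + G (s + i)) (index₁ s i) ⟩
  G (s + sucℤ i) + G (s + i)      ∎
  where
  open ≡-Reasoning
  index₁ : ∀ s i → 1ℤ + (s + i) ≡ s + (1ℤ + i)
  index₁ = solve-∀
  index₂ : ∀ s i → s + (1ℤ + (1ℤ + i)) ≡ 1ℤ + (1ℤ + (s + i))
  index₂ = solve-∀

-- With `F` for `G` this is the shape of the right-hand sides of the addition and subtraction
-- formulas, so that uniqueness applies to them.
gibonacci-combination : ∀ {G} → Gibonacci G → ∀ u v → Gibonacci (λ i → G i * u + G (sucℤ i) * v)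
gibonacci-combination {G} gG u v .recurrence i rewrite gG .recurrence (sucℤ i) | gG .recurrence i = identity (G i) (G (sucℤ i)) u v
  where
  identity : ∀ g h u v → (h + g) * u + (h + g + h) * v ≡ h * u + (h + g) * v + (g * u + h * v)
  identity = solve-∀

-- Alternating signs, addition and subtraction formulas, Cassini's identity

-1^-suc : ∀ i → -1^ sucℤ i ≡ - (-1^ i)
-1^-suc (+ n)        = ℤ.-1*i≡-i (-1^ (+ n))
-1^-suc -[1+ 0 ]     = refl
-- For a negative index the successor has smaller absolute value, so a factor -1 is lost rather than
-- gained, and two negations cancel.
-1^-suc -[1+ suc n ] = sym (trans (cong -_ (ℤ.-1*i≡-i (-1^ (+ suc n)))) (ℤ.neg-involutive (-1^ (+ suc n))))

gibonacci-down : ∀ {G} → Gibonacci G → ∀ s i → G (s - i) ≡ G (s - sucℤ i) + G (s - sucℤ (sucℤ i))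
gibonacci-down {G} gG s i = begin
  G (s - i)
    ≡⟨ cong G (index₂ s i) ⟩
  G (sucℤ (sucℤ (s - sucℤ (sucℤ i))))
    ≡⟨ gG .recurrence (s - sucℤ (sucℤ i)) ⟩
  G (sucℤ (s - sucℤ (sucℤ i))) + G (s - sucℤ (sucℤ i))
    ≡⟨ cong (λ j → G j + G (s - sucℤ (sucℤ i))) (index₁ s i) ⟩
  G (s - sucℤ i) + G (s - sucℤ (sucℤ i)) ∎
  where
  open ≡-Reasoning
  index₁ : ∀ s i → 1ℤ + (s - (1ℤ + (1ℤ + i))) ≡ s - (1ℤ + i)
  index₁ = solve-∀
  index₂ : ∀ s i → s - i ≡ 1ℤ + (1ℤ + (s - (1ℤ + (1ℤ + i))))
  index₂ = solve-∀

-- Reversing the index moves the sum in the recurrence to the other end; the alternating sign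
-- restores the original form.
gibonacci-reflect : ∀ {G} → Gibonacci G → ∀ s → Gibonacci (λ i → -1^ i * G (s - i))
gibonacci-reflect {G} gG s .recurrence i = begin
  -1^ sucℤ (sucℤ i) * h          ≡⟨ cong (_* h) (trans (-1^-suc (sucℤ i)) (cong -_ (-1^-suc i))) ⟩
  - - -1^ i * h                  ≡⟨ identity (-1^ i) g h ⟩
  - -1^ i * g + -1^ i * (g + h)  ≡⟨ cong₂ (λ e k → e * g + -1^ i * k) (-1^-suc i) (gibonacci-down gG s i) ⟨
  -1^ sucℤ i * g + -1^ i * G (s - i) ∎
  where
  open ≡-Reasoning
  g h : ℤ
  g = G (s - sucℤ i)
  h = G (s - sucℤ (sucℤ i))
  identity : ∀ e g h → - - e * h ≡ - e * g + e * (g + h)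
  identity = solve-∀

-- Both sides are Gibonacci in `i` and agree at 0 and 1. The difference stands for G(s-1), so that
-- only `G s` and `G (sucℤ s)` occur.
gibonacci-addition : ∀ {G} → Gibonacci G → ∀ s i →
                     G (s + i) ≡ F i * (G (sucℤ s) - G s) + F (sucℤ i) * G s
gibonacci-addition {G} gG s = gibonacci-unique (gibonacci-shift gG s)
  (gibonacci-combination F-gibonacci (G (sucℤ s) - G s) (G s))
  (trans (cong G (ℤ.+-identityʳ s)) (at0 (G s) (G (sucℤ s))))
  (trans (cong G (ℤ.+-comm s 1ℤ)) (at1 (G s) (G (sucℤ s))))
  where
  at0 : ∀ g h → g ≡ 0ℤ * (h - g) + 1ℤ * g
  at0 = solve-∀
  at1 : ∀ g h → h ≡ 1ℤ * (h - g) + 1ℤ * g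
  at1 = solve-∀

gibonacci-addition-suc : ∀ {G} → Gibonacci G → ∀ s i →
                         G (sucℤ (s + i)) ≡ F i * G s + F (sucℤ i) * G (sucℤ s)
gibonacci-addition-suc {G} gG s i = begin
  G (1ℤ + (s + i))
    ≡⟨ cong G (ℤ.+-assoc 1ℤ s i) ⟨
  G (sucℤ s + i)
    ≡⟨ gibonacci-addition gG (sucℤ s) i ⟩
  F i * (G (sucℤ (sucℤ s)) - G (sucℤ s)) + F (sucℤ i) * G (sucℤ s)
    ≡⟨ cong (λ g → F i * (g - G (sucℤ s)) + F (sucℤ i) * G (sucℤ s)) (gG .recurrence s) ⟩
  F i * (G (sucℤ s) + G s - G (sucℤ s)) + F (sucℤ i) * G (sucℤ s)
    ≡⟨ identity (F i) (F (sucℤ i)) (G s) (G (sucℤ s)) ⟩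
  F i * G s + F (sucℤ i) * G (sucℤ s) ∎
  where
  open ≡-Reasoning
  identity : ∀ a b g h → a * (h + g - h) + b * h ≡ a * g + b * h
  identity = solve-∀

-- The sign stays on the left because it is the signed reflection that is Gibonacci in `i`;
-- uniqueness then applies as for addition.
gibonacci-subtraction : ∀ {G} → Gibonacci G → ∀ s i →
                        -1^ i * G (s - i) ≡ F i * - G (sucℤ s) + F (sucℤ i) * G s
gibonacci-subtraction {G} gG s = gibonacci-unique (gibonacci-reflect gG s)
  (gibonacci-combination F-gibonacci (- G (sucℤ s)) (G s))
  (trans (cong (λ j → 1ℤ * G j) (ℤ.+-identityʳ s)) (at0 (G s) (G (sucℤ s))))
  (trans (at1 (G (s - 1ℤ)) (G s)) (cong (λ g → 1ℤ * - g + 1ℤ * G s) G[s+1]))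
  where
  at0 : ∀ g h → 1ℤ * g ≡ 0ℤ * - h + 1ℤ * g
  at0 = solve-∀
  at1 : ∀ g h → -1ℤ * g ≡ 1ℤ * - (h + g) + 1ℤ * h
  at1 = solve-∀
  index₁ : ∀ s → 1ℤ + (s - 1ℤ) ≡ s
  index₁ = solve-∀
  G[s+1] : G s + G (s - 1ℤ) ≡ G (sucℤ s)
  G[s+1] = begin
    G s + G (s - 1ℤ)               ≡⟨ cong (λ j → G j + G (s - 1ℤ)) (index₁ s) ⟨
    G (sucℤ (s - 1ℤ)) + G (s - 1ℤ) ≡⟨ gG .recurrence (s - 1ℤ) ⟨
    G (sucℤ (sucℤ (s - 1ℤ)))       ≡⟨ cong (λ j → G (sucℤ j)) (index₁ s) ⟩
    G (sucℤ s)                     ∎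
    where open ≡-Reasoning

-1^-square : ∀ i → -1^ i * -1^ i ≡ 1ℤ
-1^-square i = square ∣ i ∣
  where
  identity : ∀ e → -1ℤ * e * (-1ℤ * e) ≡ e * e
  identity = solve-∀
  square : ∀ n → -1^ (+ n) * -1^ (+ n) ≡ 1ℤ
  square zero    = refl
  square (suc n) = trans (identity (-1^ (+ n))) (square n)

-- The subtraction formula from i+1 to 1, where `F` is 1. It turns the sign into a polynomial, which
-- the ring solver can handle.
cassini : ∀ i → -1^ i ≡ F (sucℤ i) * F (sucℤ i) - F i * F (sucℤ i) - F i * F i
cassini i = begin
  -1^ i                                                          ≡⟨ ℤ.*-identityʳ (-1^ i) ⟨
  -1^ i * 1ℤ                                                     ≡⟨ cong (λ j → -1^ i * F j) (index i) ⟨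
  -1^ i * F (sucℤ i - i)                                         ≡⟨ gibonacci-subtraction F-gibonacci (sucℤ i) i ⟩
  F i * - F (sucℤ (sucℤ i)) + F (sucℤ i) * F (sucℤ i)            ≡⟨ cong (λ g → F i * - g + F (sucℤ i) * F (sucℤ i)) (F-gibonacci .recurrence i) ⟩
  F i * - (F (sucℤ i) + F i) + F (sucℤ i) * F (sucℤ i)           ≡⟨ identity (F i) (F (sucℤ i)) ⟩
  F (sucℤ i) * F (sucℤ i) - F i * F (sucℤ i) - F i * F i         ∎
  where
  open ≡-Reasoning
  index : ∀ i → 1ℤ + i - i ≡ 1ℤ
  index = solve-∀
  identity : ∀ a b → a * - (b + a) + b * b ≡ b * b - a * b - a * a
  identity = solve-∀

gibonacci-subtraction′ : ∀ {G} → Gibonacci G → ∀ s q → G (s - q) ≡ -1^ q * (F q * - G (sucℤ s) + F (sucℤ q) * G s)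
gibonacci-subtraction′ {G} gG s q = begin
  G (s - q)                     ≡⟨ ℤ.*-identityˡ _ ⟨
  1ℤ * G (s - q)                ≡⟨ cong (_* G (s - q)) (-1^-square q) ⟨
  -1^ q * -1^ q * G (s - q)     ≡⟨ ℤ.*-assoc (-1^ q) (-1^ q) _ ⟩
  -1^ q * (-1^ q * G (s - q))   ≡⟨ cong (-1^ q *_) (gibonacci-subtraction gG s q) ⟩
  -1^ q * (F q * - G (sucℤ s) + F (sucℤ q) * G s) ∎
  where open ≡-Reasoning

-- Two shifts by `p` from s+q. The coefficients are F(2p) = F(p)(2F(p+1) - F(p)) and F(2p+1) = F(p)²
-- + F(p+1)².
gibonacci-double-shift : ∀ {G} → Gibonacci G → ∀ s p q →
  G (s + (+ 2 * p + q)) ≡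
  F p * (+ 2 * F (sucℤ p) - F p) * (G (sucℤ (s + q)) - G (s + q)) +
  (F p * F p + F (sucℤ p) * F (sucℤ p)) * G (s + q)
gibonacci-double-shift {G} gG s p q = begin
  G (s + (+ 2 * p + q))
    ≡⟨ cong G (index s p q) ⟩
  G (r + p + p)
    ≡⟨ gibonacci-addition gG (r + p) p ⟩
  F p * (G (sucℤ (r + p)) - G (r + p)) + F (sucℤ p) * G (r + p)
    ≡⟨ cong₂ (λ h g → F p * (h - g) + F (sucℤ p) * g) (gibonacci-addition-suc gG r p) (gibonacci-addition gG r p) ⟩
  F p * (F p * G r + F (sucℤ p) * G (sucℤ r) - (F p * (G (sucℤ r) - G r) + F (sucℤ p) * G r))
    + F (sucℤ p) * (F p * (G (sucℤ r) - G r) + F (sucℤ p) * G r)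
    ≡⟨ identity (F p) (F (sucℤ p)) (G r) (G (sucℤ r)) ⟩
  F p * (+ 2 * F (sucℤ p) - F p) * (G (sucℤ r) - G r) + (F p * F p + F (sucℤ p) * F (sucℤ p)) * G r ∎
  where
  open ≡-Reasoning
  r : ℤ
  r = s + q
  index : ∀ s p q → s + (+ 2 * p + q) ≡ s + q + p + p
  index = solve-∀
  identity : ∀ a b g h → a * (a * g + b * h - (a * (h - g) + b * g)) + b * (a * (h - g) + b * g) ≡
                         a * (+ 2 * b - a) * (h - g) + (a * a + b * b) * g
  identity = solve-∀

-- The shift identities for Fibonacci and Lucas weights

L-as-F : ∀ i → L i ≡ F i * -1ℤ + F (sucℤ i) * + 2
L-as-F i = trans (cong L (sym (ℤ.+-identityˡ i))) (gibonacci-addition L-gibonacci 0ℤ i)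

L-suc-as-F : ∀ i → L (sucℤ i) ≡ F i * + 2 + F (sucℤ i) * 1ℤ
L-suc-as-F i = trans (cong (λ j → L (sucℤ j)) (sym (ℤ.+-identityˡ i))) (gibonacci-addition-suc L-gibonacci 0ℤ i)

-- Every term, the sign included, is a polynomial in F(p), F(p+1), F(q), F(q+1), G(s), G(s+1); what
-- remains is a polynomial identity. The double shift is expanded first, since it leaves values at
-- s+q and s+q+1 for the later formulas.
F-shift-identity : ∀ {G} → Gibonacci G → ∀ p q s →
        F (p + q) * F (p + q) * G (s + q) + F p * F p * G (s - q) ≡
        F q * F q * G (s + (+ 2 * p + q)) + + 2 * (-1^ q * (F (p + q) * F p)) * G s
F-shift-identity {G} gG p q s
  rewrite gibonacci-double-shift gG s p q | gibonacci-subtraction′ gG s q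
        | gibonacci-addition-suc gG s q | gibonacci-addition gG s q
        | gibonacci-addition F-gibonacci p q | cassini q
  = identity (F p) (F (sucℤ p)) (F q) (F (sucℤ q)) (G s) (G (sucℤ s))
  where
  identity : ∀ a a′ b b′ g h →
    (b * (a′ - a) + b′ * a) * (b * (a′ - a) + b′ * a) * (b * (h - g) + b′ * g)
      + a * a * ((b′ * b′ - b * b′ - b * b) * (b * - h + b′ * g)) ≡
    b * b * (a * (+ 2 * a′ - a) * (b * g + b′ * h - (b * (h - g) + b′ * g))
               + (a * a + a′ * a′) * (b * (h - g) + b′ * g))
      + + 2 * ((b′ * b′ - b * b′ - b * b) * ((b * (a′ - a) + b′ * a) * a)) * g
  identity = solve-∀

-- The same reduction, with L(p) and L(p+1) also written through F(p) and F(p+1).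
L-shift-identity : ∀ {G} → Gibonacci G → ∀ p q s →
        L (p + q) * L (p + q) * G (s + q) + L p * L p * G (s - q) ≡
        + 5 * (F q * F q) * G (s + (+ 2 * p + q)) + + 2 * (-1^ q * (L (p + q) * L p)) * G s
L-shift-identity {G} gG p q s
  rewrite gibonacci-double-shift gG s p q | gibonacci-subtraction′ gG s q
        | gibonacci-addition-suc gG s q | gibonacci-addition gG s q
        | gibonacci-addition L-gibonacci p q | cassini q | L-as-F p | L-suc-as-F p
  = identity (F p) (F (sucℤ p)) (F q) (F (sucℤ q)) (G s) (G (sucℤ s))
  where
  identity : ∀ a a′ b b′ g h → let l = a * -1ℤ + a′ * + 2; l′ = a * + 2 + a′ * 1ℤ in
    (b * (l′ - l) + b′ * l) * (b * (l′ - l) + b′ * l) * (b * (h - g) + b′ * g)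
      + l * l * ((b′ * b′ - b * b′ - b * b) * (b * - h + b′ * g)) ≡
    + 5 * (b * b) * (a * (+ 2 * a′ - a) * (b * g + b′ * h - (b * (h - g) + b′ * g))
               + (a * a + a′ * a′) * (b * (h - g) + b′ * g))
      + + 2 * ((b′ * b′ - b * b′ - b * b) * ((b * (l′ - l) + b′ * l) * l)) * g
  identity = solve-∀

-- Homogeneous sums with Morgan-Voyce coefficients

-- Σ_{k ≤ n} g(k) c^(n-k)
homogeneousSum : ℤ → (ℕ → ℤ) → ℕ → ℤ
homogeneousSum c g zero    = g 0
homogeneousSum c g (suc n) = g 0 * c ^ suc n + homogeneousSum c (g ∘ suc) n

module _ (c : ℤ) where
  homogeneousSum-cong : ∀ {g h} → (∀ k → g k ≡ h k) → ∀ n → homogeneousSum c g n ≡ homogeneousSum c h n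
  homogeneousSum-cong eq zero    = eq 0
  homogeneousSum-cong eq (suc n) =
    cong₂ _+_ (cong (_* c ^ suc n) (eq 0)) (homogeneousSum-cong (eq ∘ suc) n)

  homogeneousSum-+ : ∀ g h n → homogeneousSum c (λ k → g k + h k) n ≡ homogeneousSum c g n + homogeneousSum c h n
  homogeneousSum-+ g h zero    = refl
  homogeneousSum-+ g h (suc n) = trans
    (cong (λ s → (g 0 + h 0) * c ^ suc n + s) (homogeneousSum-+ (g ∘ suc) (h ∘ suc) n))
    (identity (g 0) (h 0) (c ^ suc n) (homogeneousSum c (g ∘ suc) n) (homogeneousSum c (h ∘ suc) n))
    where
    identity : ∀ a b d x y → (a + b) * d + (x + y) ≡ a * d + x + (b * d + y)
    identity = solve-∀

  homogeneousSum-* : ∀ z g n → homogeneousSum c (λ k → z * g k) n ≡ z * homogeneousSum c g n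
  homogeneousSum-* z g zero    = refl
  homogeneousSum-* z g (suc n) = trans
    (cong (λ s → z * g 0 * c ^ suc n + s) (homogeneousSum-* z (g ∘ suc) n))
    (identity z (g 0) (c ^ suc n) (homogeneousSum c (g ∘ suc) n))
    where
    identity : ∀ z a d x → z * a * d + z * x ≡ z * (a * d + x)
    identity = solve-∀

  -- The definition splits off k = 0; here the top term is split off, and every other term gains one
  -- factor `c`.
  homogeneousSum-snoc : ∀ g n → homogeneousSum c g (suc n) ≡ c * homogeneousSum c g n + g (suc n)
  homogeneousSum-snoc g zero    = identity c (g 0) (g 1)
    where
    identity : ∀ c a b → a * (c * 1ℤ) + b ≡ c * a + b
    identity = solve-∀
  homogeneousSum-snoc g (suc n) = trans
    (cong (λ s → g 0 * c ^ suc (suc n) + s) (homogeneousSum-snoc (g ∘ suc) n))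
    (identity c (g 0) (c ^ suc n) (homogeneousSum c (g ∘ suc) n) (g (suc (suc n))))
    where
    identity : ∀ c a d x y → a * (c * d) + (c * x + y) ≡ c * (a * d + x) + y
    identity = solve-∀

-- Morgan-Voyce and Lucas-type coefficients as binomials

pascal : ∀ n k → suc n C suc k ≡ n C k ℕ.+ n C suc k
pascal n k = sym (nCk+nC[k+1]≡[n+1]C[k+1] n k)

-- Coefficients of x^k in the Morgan-Voyce polynomials b_n and B_n respectively.
evenC oddC : ℕ → ℕ → ℕ
evenC n k = (n ℕ.+ k) C (2 ℕ.* k)
oddC  n k = suc (n ℕ.+ k) C suc (2 ℕ.* k)

-- Coefficient form of b_(n+1) = b_n + x B_n.
evenC-suc : ∀ n k → evenC (suc n) (suc k) ≡ oddC n k ℕ.+ evenC n (suc k)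
evenC-suc n k rewrite ℕ.+-suc n k | ℕ.+-suc k (k ℕ.+ 0) = pascal (suc (n ℕ.+ k)) (suc (2 ℕ.* k))

-- Coefficient form of B_(n+1) = B_n + b_(n+1).
oddC-suc : ∀ n k → oddC (suc n) k ≡ oddC n k ℕ.+ evenC (suc n) k
oddC-suc n k = trans (pascal (suc (n ℕ.+ k)) (2 ℕ.* k)) (ℕ.+-comm (evenC (suc n) k) (oddC n k))

-- The lower index exceeds the upper one by 1. Hence extending a sum from n to n+1 only multiplies
-- it by `c`.
evenC-last : ∀ n → evenC n (suc n) ≡ 0
evenC-last n = k>n⇒nCk≡0 (ℕ.≤-reflexive (identity n))
  where
  identity : ∀ n → suc (n ℕ.+ suc n) ≡ 2 ℕ.* suc n
  identity = ℕ.solve-∀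

oddC-last : ∀ n → oddC n (suc n) ≡ 0
oddC-last n = k>n⇒nCk≡0 (ℕ.≤-reflexive (cong suc (identity n)))
  where
  identity : ∀ n → suc (n ℕ.+ suc n) ≡ 2 ℕ.* suc n
  identity = ℕ.solve-∀

C-absorption : ∀ n k → suc k ℕ.* (suc n C suc k) ≡ suc n ℕ.* (n C k)
C-absorption n       zero    = trans (ℕ.*-identityˡ _) (trans (nC1≡n (suc n)) (sym (ℕ.*-identityʳ (suc n))))
C-absorption zero    (suc k) = trans (cong (λ z → suc (suc k) ℕ.* z) (k>n⇒nCk≡0 {1} {suc (suc k)} (s≤s (s≤s z≤n))))
  (trans (ℕ.*-zeroʳ (suc (suc k))) (sym (cong (1 ℕ.*_) (k>n⇒nCk≡0 {0} {suc k} (s≤s z≤n)))))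
C-absorption (suc n) (suc k) = begin
  suc (suc k) ℕ.* (suc (suc n) C suc (suc k))
    ≡⟨ cong (suc (suc k) ℕ.*_) (pascal (suc n) (suc k)) ⟩
  suc (suc k) ℕ.* (suc n C suc k ℕ.+ suc n C suc (suc k))
    ≡⟨ expand k (suc n C suc k) (suc n C suc (suc k)) ⟩
  suc n C suc k ℕ.+ (suc k ℕ.* (suc n C suc k) ℕ.+ suc (suc k) ℕ.* (suc n C suc (suc k)))
    ≡⟨ cong (suc n C suc k ℕ.+_) (cong₂ ℕ._+_ (C-absorption n k) (C-absorption n (suc k))) ⟩
  suc n C suc k ℕ.+ (suc n ℕ.* (n C k) ℕ.+ suc n ℕ.* (n C suc k))
    ≡⟨ cong (suc n C suc k ℕ.+_) (ℕ.*-distribˡ-+ (suc n) (n C k) (n C suc k)) ⟨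
  suc n C suc k ℕ.+ suc n ℕ.* (n C k ℕ.+ n C suc k)
    ≡⟨ cong (λ z → suc n C suc k ℕ.+ suc n ℕ.* z) (pascal n k) ⟨
  suc (suc n) ℕ.* (suc n C suc k) ∎
  where
  open ≡-Reasoning
  expand : ∀ k x y → suc (suc k) ℕ.* (x ℕ.+ y) ≡ x ℕ.+ (suc k ℕ.* x ℕ.+ suc (suc k) ℕ.* y)
  expand = ℕ.solve-∀

-- This is (n+1) C(n,k) = (n+1-k) C(n+1,k) without subtraction; Pascal's rule and absorption give
-- it.
C-ratio : ∀ n k → suc n ℕ.* (n C k) ℕ.+ k ℕ.* (suc n C k) ≡ suc n ℕ.* (suc n C k)
C-ratio n zero    = ℕ.+-identityʳ (suc n ℕ.* 1)
C-ratio n (suc k) = begin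
  suc n ℕ.* (n C suc k) ℕ.+ suc k ℕ.* (suc n C suc k) ≡⟨ cong (suc n ℕ.* (n C suc k) ℕ.+_) (C-absorption n k) ⟩
  suc n ℕ.* (n C suc k) ℕ.+ suc n ℕ.* (n C k)         ≡⟨ ℕ.+-comm (suc n ℕ.* (n C suc k)) _ ⟩
  suc n ℕ.* (n C k) ℕ.+ suc n ℕ.* (n C suc k)         ≡⟨ ℕ.*-distribˡ-+ (suc n) (n C k) (n C suc k) ⟨
  suc n ℕ.* (n C k ℕ.+ n C suc k)                     ≡⟨ cong (suc n ℕ.*_) (pascal n k) ⟨
  suc n ℕ.* (suc n C suc k)                           ∎
  where open ≡-Reasoning

evenC-symmetric : ∀ {n k} → k ℕ.≤ n → (n ℕ.+ k) C (n ℕ.∸ k) ≡ evenC n k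
evenC-symmetric {n} {k} k≤n = begin
  (n ℕ.+ k) C (n ℕ.∸ k)                ≡⟨ cong ((n ℕ.+ k) C_) (ℕ.[m+n]∸[m+o]≡n∸o k n k) ⟨
  (n ℕ.+ k) C (k ℕ.+ n ℕ.∸ (k ℕ.+ k))  ≡⟨ cong₂ (λ i j → (n ℕ.+ k) C (i ℕ.∸ (k ℕ.+ j))) (ℕ.+-comm n k) (ℕ.+-identityʳ k) ⟨
  (n ℕ.+ k) C (n ℕ.+ k ℕ.∸ 2 ℕ.* k)    ≡⟨ nCk≡nC[n∸k] 2k≤n+k ⟨
  evenC n k                             ∎
  where
  open ≡-Reasoning
  2k≤n+k : 2 ℕ.* k ℕ.≤ n ℕ.+ k
  2k≤n+k = ℕ.+-mono-≤ k≤n (ℕ.≤-reflexive (ℕ.+-identityʳ k))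

-- Indexed by n - 1, since C(n+k-1,2k) would need truncated subtraction at n = k = 0.
lucasC : ℕ → ℕ → ℕ
lucasC n k = evenC (suc n) k ℕ.+ evenC n k

-- With N = n+1+k, `C-ratio` gives N C(N-1,2k) = (N-2k) C(N,2k), so the left side is (2N-2k)
-- C(N,2k), and 2N-2k = 2(n+1). Adding 2k C(N,2k) to both sides avoids the subtraction.
lucasC-binomial : ∀ {n k} → k ℕ.≤ suc n →
                  (suc n ℕ.+ k) ℕ.* lucasC n k ≡ 2 ℕ.* (suc n ℕ.* ((suc n ℕ.+ k) C (suc n ℕ.∸ k)))
lucasC-binomial {n} {k} k≤n rewrite evenC-symmetric k≤n = ℕ.+-cancelʳ-≡ (2 ℕ.* k ℕ.* evenC (suc n) k) _ _ (begin
  N ℕ.* (evenC (suc n) k ℕ.+ evenC n k) ℕ.+ 2 ℕ.* k ℕ.* evenC (suc n) k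
    ≡⟨ expand N (evenC (suc n) k) (evenC n k) (2 ℕ.* k) ⟩
  N ℕ.* evenC (suc n) k ℕ.+ (N ℕ.* evenC n k ℕ.+ 2 ℕ.* k ℕ.* evenC (suc n) k)
    ≡⟨ cong (N ℕ.* evenC (suc n) k ℕ.+_) (C-ratio (n ℕ.+ k) (2 ℕ.* k)) ⟩
  N ℕ.* evenC (suc n) k ℕ.+ N ℕ.* evenC (suc n) k
    ≡⟨ collect n k (evenC (suc n) k) ⟩
  2 ℕ.* (suc n ℕ.* evenC (suc n) k) ℕ.+ 2 ℕ.* k ℕ.* evenC (suc n) k ∎)
  where
  open ≡-Reasoning
  N : ℕ
  N = suc n ℕ.+ k
  expand : ∀ N e e′ j → N ℕ.* (e ℕ.+ e′) ℕ.+ j ℕ.* e ≡ N ℕ.* e ℕ.+ (N ℕ.* e′ ℕ.+ j ℕ.* e)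
  expand = ℕ.solve-∀
  collect : ∀ n k e → (suc n ℕ.+ k) ℕ.* e ℕ.+ (suc n ℕ.+ k) ℕ.* e ≡ 2 ℕ.* (suc n ℕ.* e) ℕ.+ 2 ℕ.* k ℕ.* e
  collect = ℕ.solve-∀

-- Homogenised Morgan-Voyce polynomials in the shift operator

module MorganVoyce (c f m : ℤ) (U : ℤ → ℤ) where
  -- The operator (f E^m)^k applied to `U`, evaluated at `t`.
  term : ℤ → ℕ → ℤ
  term t k = f ^ k * U (+ k * m + t)

  term-zero : ∀ t → term t 0 ≡ U t
  term-zero t = trans (ℤ.*-identityˡ _) (cong U (ℤ.+-identityˡ t))

  term-suc : ∀ t k → term t (suc k) ≡ f * term (t + m) k
  term-suc t k = trans (ℤ.*-assoc f (f ^ k) _) (cong (λ s → f * (f ^ k * U s)) (index (+ k) m t))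
    where
    index : ∀ k m t → (1ℤ + k) * m + t ≡ k * m + (t + m)
    index = solve-∀

  coefficientSum : (ℕ → ℕ) → ℤ → ℕ → ℤ
  coefficientSum a t = homogeneousSum c (λ k → + a k * term t k)

  coefficientSum-+ : ∀ a b t n → coefficientSum (λ k → a k ℕ.+ b k) t n ≡ coefficientSum a t n + coefficientSum b t n
  coefficientSum-+ a b t n = trans
    (homogeneousSum-cong c (λ k → ℤ.*-distribʳ-+ (term t k) (+ a k) (+ b k)) n)
    (homogeneousSum-+ c (λ k → + a k * term t k) (λ k → + b k * term t k) n)

  coefficientSum-snoc : ∀ a n t → a (suc n) ≡ 0 → coefficientSum a t (suc n) ≡ c * coefficientSum a t n
  coefficientSum-snoc a n t eq = begin
    coefficientSum a t (suc n)                              ≡⟨ homogeneousSum-snoc c (λ k → + a k * term t k) n ⟩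
    c * coefficientSum a t n + + a (suc n) * term t (suc n) ≡⟨ cong (λ z → c * coefficientSum a t n + + z * term t (suc n)) eq ⟩
    c * coefficientSum a t n + 0ℤ                           ≡⟨ ℤ.+-identityʳ _ ⟩
    c * coefficientSum a t n                                ∎
    where open ≡-Reasoning

  -- The polynomials b_n and B_n, made homogeneous of degree n by `c`, at f E^m.
  S R : ℕ → ℤ → ℤ
  S n t = coefficientSum (evenC n) t n
  R n t = coefficientSum (oddC n) t n

  S-zero : ∀ t → S 0 t ≡ U t
  S-zero t = trans (ℤ.*-identityˡ _) (term-zero t)

  S-suc : ∀ n t → S (suc n) t ≡ c * S n t + f * R n (t + m)
  S-suc n t = begin
    first + homogeneousSum c (λ k → + evenC (suc n) (suc k) * term t (suc k)) n
      ≡⟨ cong (λ z → first + z) (homogeneousSum-cong c split n) ⟩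
    first + homogeneousSum c (λ k → f * (+ oddC n k * term (t + m) k) + + evenC n (suc k) * term t (suc k)) n
      ≡⟨ cong (λ z → first + z) (homogeneousSum-+ c (λ k → f * (+ oddC n k * term (t + m) k)) (λ k → + evenC n (suc k) * term t (suc k)) n) ⟩
    first + (homogeneousSum c (λ k → f * (+ oddC n k * term (t + m) k)) n + rest)
      ≡⟨ cong (λ z → first + (z + rest)) (homogeneousSum-* c f (λ k → + oddC n k * term (t + m) k) n) ⟩
    first + (f * R n (t + m) + rest)
      ≡⟨ swap first _ rest ⟩
    first + rest + f * R n (t + m)
      ≡⟨ cong (_+ f * R n (t + m)) (coefficientSum-snoc (evenC n) n t (evenC-last n)) ⟩
    c * S n t + f * R n (t + m) ∎
    where
    open ≡-Reasoning
    first rest : ℤ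
    -- The coefficient at k = 0 is 1 for every n, so `first + rest` is also the sum for `evenC n`
    -- taken up to n+1.
    first = 1ℤ * term t 0 * c ^ suc n
    rest  = homogeneousSum c (λ k → + evenC n (suc k) * term t (suc k)) n
    swap : ∀ x y z → x + (y + z) ≡ x + z + y
    swap = solve-∀
    distrib : ∀ o e f u → (o + e) * (f * u) ≡ f * (o * u) + e * (f * u)
    distrib = solve-∀
    split : ∀ k → + evenC (suc n) (suc k) * term t (suc k) ≡
                  f * (+ oddC n k * term (t + m) k) + + evenC n (suc k) * term t (suc k)
    split k rewrite evenC-suc n k | term-suc t k | ℤ.pos-+ (oddC n k) (evenC n (suc k)) =
      distrib (+ oddC n k) (+ evenC n (suc k)) f (term (t + m) k)

  R-suc : ∀ n t → R (suc n) t ≡ c * R n t + S (suc n) t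
  R-suc n t = begin
    R (suc n) t
      ≡⟨ homogeneousSum-cong c (λ k → cong (λ a → + a * term t k) (oddC-suc n k)) (suc n) ⟩
    coefficientSum (λ k → oddC n k ℕ.+ evenC (suc n) k) t (suc n)
      ≡⟨ coefficientSum-+ (oddC n) (evenC (suc n)) t (suc n) ⟩
    coefficientSum (oddC n) t (suc n) + S (suc n) t
      ≡⟨ cong (_+ S (suc n) t) (coefficientSum-snoc (oddC n) n t (oddC-last n)) ⟩
    c * R n t + S (suc n) t ∎
    where open ≡-Reasoning

  -- Elimination of `R` from the two first order recurrences.
  S-recurrence : ∀ n t → S (suc (suc n)) t ≡ f * S (suc n) (t + m) + + 2 * c * S (suc n) t - c * c * S n t
  S-recurrence n t = begin
    S (suc (suc n)) t
      ≡⟨ S-suc (suc n) t ⟩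
    c * S (suc n) t + f * R (suc n) (t + m)
      ≡⟨ cong (λ z → c * S (suc n) t + f * z) (R-suc n (t + m)) ⟩
    c * S (suc n) t + f * (c * R n (t + m) + S (suc n) (t + m))
      -- Adding and subtracting c² S_n completes c f R_n to c S_(n+1).
      ≡⟨ introduce c f (S (suc n) t) (R n (t + m)) (S (suc n) (t + m)) (S n t) ⟩
    f * S (suc n) (t + m) + c * S (suc n) t + c * (c * S n t + f * R n (t + m)) - c * c * S n t
      ≡⟨ cong (λ z → f * S (suc n) (t + m) + c * S (suc n) t + c * z - c * c * S n t) (S-suc n t) ⟨
    f * S (suc n) (t + m) + c * S (suc n) t + c * S (suc n) t - c * c * S n t
      ≡⟨ collect c (f * S (suc n) (t + m)) (S (suc n) t) (c * c * S n t) ⟩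
    f * S (suc n) (t + m) + + 2 * c * S (suc n) t - c * c * S n t ∎
    where
    open ≡-Reasoning
    introduce : ∀ c f s r s′ s₀ → c * s + f * (c * r + s′) ≡ f * s′ + c * s + c * (c * s₀ + f * r) - c * c * s₀
    introduce = solve-∀
    collect : ∀ c a s b → a + c * s + c * s - b ≡ a + + 2 * c * s - b
    collect = solve-∀

  coefficientSum-lucasC : ∀ n t → coefficientSum (lucasC n) t (suc n) ≡ S (suc n) t + c * S n t
  coefficientSum-lucasC n t = trans
    (coefficientSum-+ (evenC (suc n)) (evenC n) t (suc n))
    (cong (λ z → S (suc n) t + z) (coefficientSum-snoc (evenC n) n t (evenC-last n)))

-- Power sums of the two commuting operators

module PowerSum (x y f c m q : ℤ) (U : ℤ → ℤ)
  (c² : c * c ≡ x * x * (y * y))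
  (key : ∀ s → x * x * U (s + q) + y * y * U (s - q) ≡ f * U (s + m) + + 2 * c * U s)
  where
  open MorganVoyce c f m U

  -- The operator Xⁿ + Yⁿ applied to `U`, evaluated at `t`.
  H : ℕ → ℤ → ℤ
  H n t = (x * x) ^ n * U (t + q * + n) + (y * y) ^ n * U (t - q * + n)

  H-zero : ∀ t → H 0 t ≡ + 2 * U t
  H-zero t = trans
    (cong₂ (λ i j → 1ℤ * U i + 1ℤ * U j) (index₊ t q) (index₋ t q))
    (identity (U t))
    where
    index₊ : ∀ t q → t + q * 0ℤ ≡ t
    index₊ = solve-∀
    index₋ : ∀ t q → t - q * 0ℤ ≡ t
    index₋ = solve-∀
    identity : ∀ u → 1ℤ * u + 1ℤ * u ≡ + 2 * u
    identity = solve-∀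

  H-one : ∀ t → H 1 t ≡ f * U (t + m) + + 2 * c * U t
  H-one t = trans
    (cong₂ _+_ (cong₂ _*_ (ℤ.^-identityʳ (x * x)) (cong (λ i → U (t + i)) (ℤ.*-identityʳ q)))
               (cong₂ _*_ (ℤ.^-identityʳ (y * y)) (cong (λ i → U (t - i)) (ℤ.*-identityʳ q))))
    (key t)

  -- Newton's relation X^(n+2) + Y^(n+2) = (X+Y)(X^(n+1) + Y^(n+1)) - XY(Xⁿ + Yⁿ), with `key`
  -- replacing X+Y and `c²` replacing XY.
  H-recurrence : ∀ n t → H (suc (suc n)) t ≡ f * H (suc n) (t + m) + + 2 * c * H (suc n) t - c * c * H n t
  H-recurrence n t = begin
    X * (X * A) * U (t + q * + suc (suc n)) + Y * (Y * B) * U (t - q * + suc (suc n))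
      ≡⟨ cong₂ (λ i j → X * (X * A) * U i + Y * (Y * B) * U j) (up₊ t q (+ n)) (up₋ t q (+ n)) ⟩
    X * (X * A) * U (s + q) + Y * (Y * B) * U (s′ - q)
      ≡⟨ introduce X Y A B (U (s + q)) (U (s - q)) (U (s′ + q)) (U (s′ - q)) ⟩
    X * A * (X * U (s + q) + Y * U (s - q)) + Y * B * (X * U (s′ + q) + Y * U (s′ - q))
      - X * Y * (A * U (s - q) + B * U (s′ + q))
      ≡⟨ cong₂ (λ g h → X * A * g + Y * B * h - X * Y * (A * U (s - q) + B * U (s′ + q))) (key s) (key s′) ⟩
    X * A * (f * U (s + m) + + 2 * c * U s) + Y * B * (f * U (s′ + m) + + 2 * c * U s′)
      - X * Y * (A * U (s - q) + B * U (s′ + q))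
      ≡⟨ cong (λ d → X * A * (f * U (s + m) + + 2 * c * U s) + Y * B * (f * U (s′ + m) + + 2 * c * U s′) - d * (A * U (s - q) + B * U (s′ + q))) c² ⟨
    X * A * (f * U (s + m) + + 2 * c * U s) + Y * B * (f * U (s′ + m) + + 2 * c * U s′)
      - c * c * (A * U (s - q) + B * U (s′ + q))
      ≡⟨ collect c f (X * A) (Y * B) (U (s + m)) (U (s′ + m)) (U s) (U s′) (c * c * (A * U (s - q) + B * U (s′ + q))) ⟩
    f * (X * A * U (s + m) + Y * B * U (s′ + m)) + + 2 * c * H (suc n) t - c * c * (A * U (s - q) + B * U (s′ + q))
      ≡⟨ cong₂ (λ i j → f * (X * A * U i + Y * B * U j) + + 2 * c * H (suc n) t - c * c * (A * U (s - q) + B * U (s′ + q)))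
           (across₊ t q (+ n) m) (across₋ t q (+ n) m) ⟩
    f * H (suc n) (t + m) + + 2 * c * H (suc n) t - c * c * (A * U (s - q) + B * U (s′ + q))
      ≡⟨ cong₂ (λ i j → f * H (suc n) (t + m) + + 2 * c * H (suc n) t - c * c * (A * U i + B * U j))
           (down₊ t q (+ n)) (down₋ t q (+ n)) ⟩
    f * H (suc n) (t + m) + + 2 * c * H (suc n) t - c * c * H n t ∎
    where
    open ≡-Reasoning
    X Y A B s s′ : ℤ
    X = x * x
    Y = y * y
    A = X ^ n
    B = Y ^ n
    s  = t + q * + suc n
    s′ = t - q * + suc n
    up₊ : ∀ t q n → t + q * (1ℤ + (1ℤ + n)) ≡ t + q * (1ℤ + n) + q
    up₊ = solve-∀
    up₋ : ∀ t q n → t - q * (1ℤ + (1ℤ + n)) ≡ t - q * (1ℤ + n) - q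
    up₋ = solve-∀
    across₊ : ∀ t q n m → t + q * (1ℤ + n) + m ≡ t + m + q * (1ℤ + n)
    across₊ = solve-∀
    across₋ : ∀ t q n m → t - q * (1ℤ + n) + m ≡ t + m - q * (1ℤ + n)
    across₋ = solve-∀
    down₊ : ∀ t q n → t + q * (1ℤ + n) - q ≡ t + q * n
    down₊ = solve-∀
    down₋ : ∀ t q n → t - q * (1ℤ + n) + q ≡ t - q * n
    down₋ = solve-∀
    introduce : ∀ X Y A B u₊ u₋ v₊ v₋ → X * (X * A) * u₊ + Y * (Y * B) * v₋ ≡
      X * A * (X * u₊ + Y * u₋) + Y * B * (X * v₊ + Y * v₋) - X * Y * (A * u₋ + B * v₊)
    introduce = solve-∀
    collect : ∀ c f a b uₘ vₘ u v w → a * (f * uₘ + + 2 * c * u) + b * (f * vₘ + + 2 * c * v) - w ≡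
                                      f * (a * uₘ + b * vₘ) + + 2 * c * (a * u + b * v) - w
    collect = solve-∀

  -- Both sides obey the same second order recurrence in n, so two base cases suffice.
  H≡S+cS : ∀ n t → H (suc n) t ≡ S (suc n) t + c * S n t
  H≡S+cS zero t = begin
    H 1 t                             ≡⟨ H-one t ⟩
    f * U (t + m) + + 2 * c * U t     ≡⟨ identity c (U t) (f * U (t + m)) ⟩
    c * U t + f * U (t + m) + c * U t ≡⟨ cong₂ (λ u v → c * u + f * v + c * u) (S-zero t) (S-zero (t + m)) ⟨
    c * S 0 t + f * R 0 (t + m) + c * S 0 t ≡⟨ cong (_+ c * S 0 t) (S-suc 0 t) ⟨
    S 1 t + c * S 0 t                 ∎
    where
    open ≡-Reasoning
    identity : ∀ c u v → v + + 2 * c * u ≡ c * u + v + c * u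
    identity = solve-∀
  -- The recurrence reaches `H 0`, which the claim does not cover, so its value 2 U(t) is inserted
  -- directly.
  H≡S+cS (suc zero) t = begin
    H 2 t
      ≡⟨ H-recurrence 0 t ⟩
    f * H 1 (t + m) + + 2 * c * H 1 t - c * c * H 0 t
      ≡⟨ cong₂ (λ u v → f * u + + 2 * c * v - c * c * H 0 t) (H≡S+cS zero (t + m)) (H≡S+cS zero t) ⟩
    f * (S 1 (t + m) + c * S 0 (t + m)) + + 2 * c * (S 1 t + c * S 0 t) - c * c * H 0 t
      ≡⟨ cong (λ u → f * (S 1 (t + m) + c * S 0 (t + m)) + + 2 * c * (S 1 t + c * S 0 t) - c * c * u)
           (trans (H-zero t) (cong (+ 2 *_) (sym (S-zero t)))) ⟩
    f * (S 1 (t + m) + c * S 0 (t + m)) + + 2 * c * (S 1 t + c * S 0 t) - c * c * (+ 2 * S 0 t)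
      ≡⟨ rearrange c f (S 1 (t + m)) (S 0 (t + m)) (S 1 t) (S 0 t) ⟩
    f * S 1 (t + m) + + 2 * c * S 1 t - c * c * S 0 t + c * (c * S 0 t + f * S 0 (t + m))
      ≡⟨ cong₂ (λ u v → u + c * v) (S-recurrence 0 t) (S-suc 0 t) ⟨
    S 2 t + c * S 1 t ∎
    where
    open ≡-Reasoning
    rearrange : ∀ c f s₁ s₀ r₁ r₀ → f * (s₁ + c * s₀) + + 2 * c * (r₁ + c * r₀) - c * c * (+ 2 * r₀) ≡
                                    f * s₁ + + 2 * c * r₁ - c * c * r₀ + c * (c * r₀ + f * s₀)
    rearrange = solve-∀
  H≡S+cS (suc (suc n)) t = begin
    H (suc (suc (suc n))) t
      ≡⟨ H-recurrence (suc n) t ⟩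
    f * H (suc (suc n)) (t + m) + + 2 * c * H (suc (suc n)) t - c * c * H (suc n) t
      ≡⟨ cong₂ (λ u v → f * u + + 2 * c * v - c * c * H (suc n) t) (H≡S+cS (suc n) (t + m)) (H≡S+cS (suc n) t) ⟩
    f * (S₂ (t + m) + c * S₁ (t + m)) + + 2 * c * (S₂ t + c * S₁ t) - c * c * H (suc n) t
      ≡⟨ cong (λ u → f * (S₂ (t + m) + c * S₁ (t + m)) + + 2 * c * (S₂ t + c * S₁ t) - c * c * u) (H≡S+cS n t) ⟩
    f * (S₂ (t + m) + c * S₁ (t + m)) + + 2 * c * (S₂ t + c * S₁ t) - c * c * (S₁ t + c * S n t)
      ≡⟨ rearrange c f (S₂ (t + m)) (S₁ (t + m)) (S₂ t) (S₁ t) (S n t) ⟩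
    f * S₂ (t + m) + + 2 * c * S₂ t - c * c * S₁ t + c * (f * S₁ (t + m) + + 2 * c * S₁ t - c * c * S n t)
      ≡⟨ cong₂ (λ u v → u + c * v) (S-recurrence (suc n) t) (S-recurrence n t) ⟨
    S (suc (suc (suc n))) t + c * S₂ t ∎
    where
    open ≡-Reasoning
    S₁ S₂ : ℤ → ℤ
    S₁ = S (suc n)
    S₂ = S (suc (suc n))
    rearrange : ∀ c f s₂ s₁ r₂ r₁ r₀ → f * (s₂ + c * s₁) + + 2 * c * (r₂ + c * r₁) - c * c * (r₁ + c * r₀) ≡
      f * s₂ + + 2 * c * r₂ - c * c * r₁ + c * (f * s₁ + + 2 * c * r₁ - c * c * r₀)
    rearrange = solve-∀

  power-sum : ∀ n t → coefficientSum (lucasC n) t (suc n) ≡ H (suc n) t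
  power-sum n t = trans (coefficientSum-lucasC n t) (sym (H≡S+cS n t))

-- Passage from integer to rational sums

toℚᵘ-/1 : ∀ i → toℚᵘ (fromℤ i) ℚᵘ.≃ mkℚᵘ i 0
toℚᵘ-/1 i = ℚ.toℚᵘ-fromℚᵘ (mkℚᵘ i 0)

fromℤ-+ : ∀ i j → fromℤ (i + j) ≡ fromℤ i ℚ.+ fromℤ j
fromℤ-+ i j = ℚ.toℚᵘ-injective (begin
  toℚᵘ (fromℤ (i + j))                ≈⟨ toℚᵘ-/1 (i + j) ⟩
  mkℚᵘ (i + j) 0                      ≈⟨ *≡* (identity i j) ⟩
  mkℚᵘ i 0 ℚᵘ.+ mkℚᵘ j 0              ≈⟨ ℚᵘ.+-cong (toℚᵘ-/1 i) (toℚᵘ-/1 j) ⟨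
  toℚᵘ (fromℤ i) ℚᵘ.+ toℚᵘ (fromℤ j)  ≈⟨ ℚ.toℚᵘ-homo-+ (fromℤ i) (fromℤ j) ⟨
  toℚᵘ (fromℤ i ℚ.+ fromℤ j)          ∎)
  where
  open ℚᵘ.≃-Reasoning
  identity : ∀ i j → (i + j) * 1ℤ ≡ (i * 1ℤ + j * 1ℤ) * 1ℤ
  identity = solve-∀

-- In unnormalised rationals equality is cross multiplication, so the integer hypothesis suffices
-- and no lowest terms are computed.
/-≡-½ : ∀ i d j w r .{{_ : NonZero d}} → + 2 * (i * j * w) ≡ + d * r →
        (i / d) ℚ.* fromℤ j ℚ.* fromℤ w ≡ ½ ℚ.* fromℤ r
/-≡-½ i (suc d) j w r eq = ℚ.toℚᵘ-injective (begin
  toℚᵘ (i/d ℚ.* fromℤ j ℚ.* fromℤ w)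
    ≈⟨ ℚ.toℚᵘ-homo-* (i/d ℚ.* fromℤ j) (fromℤ w) ⟩
  toℚᵘ (i/d ℚ.* fromℤ j) ℚᵘ.* toℚᵘ (fromℤ w)
    ≈⟨ ℚᵘ.*-cong (ℚᵘ.≃-trans (ℚ.toℚᵘ-homo-* i/d (fromℤ j)) (ℚᵘ.*-cong (ℚ.toℚᵘ-fromℚᵘ (mkℚᵘ i d)) (toℚᵘ-/1 j))) (toℚᵘ-/1 w) ⟩
  mkℚᵘ i d ℚᵘ.* mkℚᵘ j 0 ℚᵘ.* mkℚᵘ w 0
    ≈⟨ *≡* cross ⟩
  toℚᵘ ½ ℚᵘ.* mkℚᵘ r 0
    ≈⟨ ℚᵘ.*-congˡ (toℚᵘ-/1 r) ⟨
  toℚᵘ ½ ℚᵘ.* toℚᵘ (fromℤ r)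
    ≈⟨ ℚ.toℚᵘ-homo-* ½ (fromℤ r) ⟨
  toℚᵘ (½ ℚ.* fromℤ r) ∎)
  where
  open ℚᵘ.≃-Reasoning
  i/d : ℚ
  i/d = i / suc d
  cross : i * j * w * + 2 ≡ 1ℤ * r * + (suc d ℕ.* 1 ℕ.* 1)
  cross rewrite ℕ.*-identityʳ d | ℕ.*-identityʳ d =
    trans (ℤ.*-comm (i * j * w) (+ 2)) (trans eq (trans (ℤ.*-comm (+ suc d) r) (cong (_* + suc d) (sym (ℤ.*-identityˡ r)))))

-- Termwise agreement is asked only for k ≤ n, the range in which the binomial symmetry is
-- available.
sum-homogeneousSum : ∀ c g n (T : ℕ → ℚ) → (∀ k → k ℕ.≤ n → T k ≡ ½ ℚ.* fromℤ (g k * c ^ (n ℕ.∸ k))) →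
                     ∑[ i ≤ n ] T (toℕ i) ≡ ½ ℚ.* fromℤ (homogeneousSum c g n)
sum-homogeneousSum c g zero    T eq = trans (ℚ.+-identityʳ (T 0)) (trans (eq 0 z≤n) (cong (λ z → ½ ℚ.* fromℤ z) (ℤ.*-identityʳ (g 0))))
sum-homogeneousSum c g (suc n) T eq = begin
  T 0 ℚ.+ ∑[ i ≤ n ] T (suc (toℕ i))
    ≡⟨ cong₂ ℚ._+_ (eq 0 z≤n) (sum-homogeneousSum c (g ∘ suc) n (T ∘ suc) (λ k k≤n → eq (suc k) (s≤s k≤n))) ⟩
  ½ ℚ.* fromℤ (g 0 * c ^ suc n) ℚ.+ ½ ℚ.* fromℤ (homogeneousSum c (g ∘ suc) n)
    ≡⟨ ℚ.*-distribˡ-+ ½ (fromℤ (g 0 * c ^ suc n)) (fromℤ (homogeneousSum c (g ∘ suc) n)) ⟨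
  ½ ℚ.* (fromℤ (g 0 * c ^ suc n) ℚ.+ fromℤ (homogeneousSum c (g ∘ suc) n))
    ≡⟨ cong (½ ℚ.*_) (fromℤ-+ (g 0 * c ^ suc n) (homogeneousSum c (g ∘ suc) n)) ⟨
  ½ ℚ.* fromℤ (homogeneousSum c g (suc n)) ∎
  where open ≡-Reasoning

^-distribʳ-* : ∀ n i j → (i * j) ^ n ≡ i ^ n * j ^ n
^-distribʳ-* zero    i j = refl
^-distribʳ-* (suc n) i j = trans (cong (i * j *_) (^-distribʳ-* n i j)) (identity i j (i ^ n) (j ^ n))
  where
  identity : ∀ i j a b → i * j * (a * b) ≡ i * a * (j * b)
  identity = solve-∀

^-double : ∀ i n → (i * i) ^ n ≡ i ^ (2 ℕ.* n)
^-double i n = trans (cong (λ j → (i * j) ^ n) (sym (ℤ.^-identityʳ i))) (ℤ.^-*-assoc i 2 n)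

-1^-* : ∀ n q → -1^ (+ n * q) ≡ (-1^ q) ^ n
-1^-* n q = begin
  -1ℤ ^ ∣ + n * q ∣       ≡⟨ cong (-1ℤ ^_) (trans (ℤ.abs-* (+ n) q) (ℕ.*-comm n ∣ q ∣)) ⟩
  -1ℤ ^ (∣ q ∣ ℕ.* n)     ≡⟨ ℤ.^-*-assoc -1ℤ ∣ q ∣ n ⟨
  (-1ℤ ^ ∣ q ∣) ^ n       ∎
  where open ≡-Reasoning

-- The common form of all four identities. `W` leaves each of them free to order its integer factors
-- in its own way.
power-sum-identity : ∀ n .{{_ : NonZero n}} (x y f m q t : ℤ) (U : ℤ → ℤ) →
  (∀ s → x * x * U (s + q) + y * y * U (s - q) ≡ f * U (s + m) + + 2 * (-1^ q * (x * y)) * U s) →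
  (W : ℕ → ℤ) → (∀ k → W k ≡ x ^ (n ℕ.∸ k) * y ^ (n ℕ.∸ k) * (f ^ k * U (+ k * m + t))) →
  ∑[ i ≤ n ] (let k = toℕ i in
    ((-1^ (+ (n ℕ.∸ k) * q) * + n) / (n ℕ.+ k)) ℚ.* fromℤ (+ ((n ℕ.+ k) C (n ℕ.∸ k))) ℚ.* fromℤ (W k))
  ≡ ½ ℚ.* fromℤ (x ^ (2 ℕ.* n) * U (t + q * + n) + y ^ (2 ℕ.* n) * U (t - q * + n))
power-sum-identity (suc n) x y f m q t U key W W≡ = begin
  ∑[ i ≤ suc n ] summand (toℕ i)
    ≡⟨ sum-homogeneousSum c (λ k → + lucasC n k * term t k) (suc n) summand summand≡ ⟩
  ½ ℚ.* fromℤ (coefficientSum (lucasC n) t (suc n))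
    ≡⟨ cong (λ z → ½ ℚ.* fromℤ z) (power-sum n t) ⟩
  ½ ℚ.* fromℤ (H (suc n) t)
    ≡⟨ cong₂ (λ a b → ½ ℚ.* fromℤ (a * U (t + q * + suc n) + b * U (t - q * + suc n))) (^-double x (suc n)) (^-double y (suc n)) ⟩
  ½ ℚ.* fromℤ (x ^ (2 ℕ.* suc n) * U (t + q * + suc n) + y ^ (2 ℕ.* suc n) * U (t - q * + suc n)) ∎
  where
  open ≡-Reasoning
  c : ℤ
  c = -1^ q * (x * y)

  c² : c * c ≡ x * x * (y * y)
  c² = trans (square (-1^ q) x y) (trans (cong (_* (x * x * (y * y))) (-1^-square q)) (ℤ.*-identityˡ _))
    where
    square : ∀ e x y → e * (x * y) * (e * (x * y)) ≡ e * e * (x * x * (y * y))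
    square = solve-∀

  open MorganVoyce c f m U
  open PowerSum x y f c m q U c² key

  summand : ℕ → ℚ
  summand k = ((-1^ (+ (suc n ℕ.∸ k) * q) * + suc n) / (suc n ℕ.+ k)) ℚ.* fromℤ (+ ((suc n ℕ.+ k) C (suc n ℕ.∸ k))) ℚ.* fromℤ (W k)

  binomial : ∀ k → k ℕ.≤ suc n → + (suc n ℕ.+ k) * + lucasC n k ≡ + 2 * (+ suc n * + ((suc n ℕ.+ k) C (suc n ℕ.∸ k)))
  binomial k k≤n = begin
    + (suc n ℕ.+ k) * + lucasC n k             ≡⟨ ℤ.pos-* (suc n ℕ.+ k) (lucasC n k) ⟨
    + ((suc n ℕ.+ k) ℕ.* lucasC n k)           ≡⟨ cong +_ (lucasC-binomial k≤n) ⟩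
    + (2 ℕ.* (suc n ℕ.* b))                   ≡⟨ ℤ.pos-* 2 (suc n ℕ.* b) ⟩
    + 2 * + (suc n ℕ.* b)                     ≡⟨ cong (+ 2 *_) (ℤ.pos-* (suc n) b) ⟩
    + 2 * (+ suc n * + b)                     ∎
    where
    b : ℕ
    b = (suc n ℕ.+ k) C (suc n ℕ.∸ k)

  summand≡ : ∀ k → k ℕ.≤ suc n → summand k ≡ ½ ℚ.* fromℤ (+ lucasC n k * term t k * c ^ (suc n ℕ.∸ k))
  summand≡ k k≤n = /-≡-½ (-1^ (+ d * q) * + suc n) (suc n ℕ.+ k) (+ b) (W k) _ (begin
    + 2 * (-1^ (+ d * q) * + suc n * + b * W k)
      ≡⟨ cong₂ (λ e w → + 2 * (e * + suc n * + b * w)) (-1^-* d q) (W≡ k) ⟩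
    + 2 * ((-1^ q) ^ d * + suc n * + b * (x ^ d * y ^ d * term t k))
      -- The sign and the powers of `x` and `y` are gathered to form c^d, and the binomial factor is
      -- isolated so that `binomial` can trade it for n+1+k.
      ≡⟨ regroup ((-1^ q) ^ d) (+ suc n) (+ b) (x ^ d) (y ^ d) (term t k) ⟩
    + 2 * (+ suc n * + b) * (term t k * ((-1^ q) ^ d * (x ^ d * y ^ d)))
      ≡⟨ cong₂ (λ l p → l * (term t k * p)) (binomial k k≤n)
           (trans (^-distribʳ-* d (-1^ q) (x * y)) (cong ((-1^ q) ^ d *_) (^-distribʳ-* d x y))) ⟨
    + (suc n ℕ.+ k) * + lucasC n k * (term t k * c ^ d)
      ≡⟨ assoc (+ (suc n ℕ.+ k)) (+ lucasC n k) (term t k) (c ^ d) ⟩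
    + (suc n ℕ.+ k) * (+ lucasC n k * term t k * c ^ d) ∎)
    where
    d b : ℕ
    d = suc n ℕ.∸ k
    b = (suc n ℕ.+ k) C d
    regroup : ∀ e n b x y u → + 2 * (e * n * b * (x * y * u)) ≡ + 2 * (n * b) * (u * (e * (x * y)))
    regroup = solve-∀
    assoc : ∀ a l u p → a * l * (u * p) ≡ a * (l * u * p)
    assoc = solve-∀

theorem14 : (n : ℕ) .{{_ : NonZero n}} (p q t : ℤ) →
    (∑[ i ≤ n ] (let k = toℕ i in
    ((-1^ (+ (n ℕ.∸ k) * q) * + n) / (n ℕ.+ k)) ℚ.* fromℤ (+ ((n ℕ.+ k) C (n ℕ.∸ k)))
    ℚ.* fromℤ (F (p + q) ^ (n ℕ.∸ k) * F p ^ (n ℕ.∸ k) * F q ^ (2 ℕ.* k) * L (+ k * (+ 2 * p + q) + t)))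
    ≡ ½ ℚ.* fromℤ (F (p + q) ^ (2 ℕ.* n) * L (t + q * + n) + F p ^ (2 ℕ.* n) * L (t - q * + n)))
    ×
    (∑[ i ≤ n ] (let k = toℕ i in
    ((-1^ (+ (n ℕ.∸ k) * q) * + n) / (n ℕ.+ k)) ℚ.* fromℤ (+ ((n ℕ.+ k) C (n ℕ.∸ k)))
    ℚ.* fromℤ (F (p + q) ^ (n ℕ.∸ k) * F p ^ (n ℕ.∸ k) * F q ^ (2 ℕ.* k) * F (+ k * (+ 2 * p + q) + t)))
    ≡ ½ ℚ.* fromℤ (F (p + q) ^ (2 ℕ.* n) * F (t + q * + n) + F p ^ (2 ℕ.* n) * F (t - q * + n)))
    ×
    (∑[ i ≤ n ] (let k = toℕ i in
    ((-1^ (+ (n ℕ.∸ k) * q) * + n) / (n ℕ.+ k)) ℚ.* fromℤ (+ ((n ℕ.+ k) C (n ℕ.∸ k)))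
    ℚ.* fromℤ ((+ 5) ^ k * L (p + q) ^ (n ℕ.∸ k) * L p ^ (n ℕ.∸ k) * F q ^ (2 ℕ.* k) * L (+ k * (+ 2 * p + q) + t)))
    ≡ ½ ℚ.* fromℤ (L (p + q) ^ (2 ℕ.* n) * L (t + q * + n) + L p ^ (2 ℕ.* n) * L (t - q * + n)))
    ×
    (∑[ i ≤ n ] (let k = toℕ i in
    ((-1^ (+ (n ℕ.∸ k) * q) * + n) / (n ℕ.+ k)) ℚ.* fromℤ (+ ((n ℕ.+ k) C (n ℕ.∸ k)))
    ℚ.* fromℤ ((+ 5) ^ k * L (p + q) ^ (n ℕ.∸ k) * L p ^ (n ℕ.∸ k) * F q ^ (2 ℕ.* k) * F (+ k * (+ 2 * p + q) + t)))
    ≡ ½ ℚ.* fromℤ (L (p + q) ^ (2 ℕ.* n) * F (t + q * + n) + L p ^ (2 ℕ.* n) * F (t - q * + n)))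
theorem14 n p q t = F-weighted L-gibonacci , F-weighted F-gibonacci , L-weighted L-gibonacci , L-weighted F-gibonacci
  where
  m : ℤ
  m = + 2 * p + q

  -- Generic in `G`, so that `L` and `F` give one identity each; here f = F(q)².
  F-weighted : ∀ {G} → Gibonacci G →
    (∑[ i ≤ n ] (let k = toℕ i in
      ((-1^ (+ (n ℕ.∸ k) * q) * + n) / (n ℕ.+ k)) ℚ.* fromℤ (+ ((n ℕ.+ k) C (n ℕ.∸ k)))
      ℚ.* fromℤ (F (p + q) ^ (n ℕ.∸ k) * F p ^ (n ℕ.∸ k) * F q ^ (2 ℕ.* k) * G (+ k * m + t))))
    ≡ ½ ℚ.* fromℤ (F (p + q) ^ (2 ℕ.* n) * G (t + q * + n) + F p ^ (2 ℕ.* n) * G (t - q * + n))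
  F-weighted {G} gG = power-sum-identity n (F (p + q)) (F p) (F q * F q) m q t G (F-shift-identity gG p q) _ λ k →
    trans (ℤ.*-assoc (F (p + q) ^ (n ℕ.∸ k) * F p ^ (n ℕ.∸ k)) (F q ^ (2 ℕ.* k)) (G (+ k * m + t)))
          (cong (λ z → F (p + q) ^ (n ℕ.∸ k) * F p ^ (n ℕ.∸ k) * (z * G (+ k * m + t))) (sym (^-double (F q) k)))

  -- Here f = 5 F(q)², whose k-th power supplies the factor 5^k.
  L-weighted : ∀ {G} → Gibonacci G →
    (∑[ i ≤ n ] (let k = toℕ i in
      ((-1^ (+ (n ℕ.∸ k) * q) * + n) / (n ℕ.+ k)) ℚ.* fromℤ (+ ((n ℕ.+ k) C (n ℕ.∸ k)))
      ℚ.* fromℤ ((+ 5) ^ k * L (p + q) ^ (n ℕ.∸ k) * L p ^ (n ℕ.∸ k) * F q ^ (2 ℕ.* k) * G (+ k * m + t))))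
    ≡ ½ ℚ.* fromℤ (L (p + q) ^ (2 ℕ.* n) * G (t + q * + n) + L p ^ (2 ℕ.* n) * G (t - q * + n))
  L-weighted {G} gG = power-sum-identity n (L (p + q)) (L p) (+ 5 * (F q * F q)) m q t G (L-shift-identity gG p q) _ λ k →
    trans (regroup ((+ 5) ^ k) (L (p + q) ^ (n ℕ.∸ k)) (L p ^ (n ℕ.∸ k)) (F q ^ (2 ℕ.* k)) (G (+ k * m + t)))
          (cong (λ z → L (p + q) ^ (n ℕ.∸ k) * L p ^ (n ℕ.∸ k) * (z * G (+ k * m + t)))
                (sym (trans (^-distribʳ-* k (+ 5) (F q * F q)) (cong ((+ 5) ^ k *_) (^-double (F q) k)))))
    where
    regroup : ∀ a x y b g → a * x * y * b * g ≡ x * y * (a * b * g)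
    regroup = solve-∀
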